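{- For every integer $n\ge 3$, the book graph $B_n$ satisfies $\operatorname{st}_{\gamma_{st}}(B_n)=1$.
   Context: All graphs are finite, simple and undirected. For a graph $G=(V,E)$, a set $D\subseteq V$ is a strong dominating set if every vertex $v\in V\setminus D$ is adjacent to some $u\in D$ with $\deg(v)\le\deg(u)$ (degrees taken in $G$). The strong domination number $\gamma_{st}(G)$ is the minimum size of a strong dominating set. For $S\subseteq V$, $G-S$ is the graph obtained by deleting the vertices of $S$. The stability of the strong domination number is $\operatorname{st}_{\gamma_{st}}(G)=\min\{|S| : S\subseteq V,\ \gamma_{st}(G-S)\ne\gamma_{st}(G)\}$. The book graph $B_n$ is the Cartesian product $K_{1,n}\,\square\,P_2$ of the star $K_{1,n}$ with the path on two vertices; it consists of $n$ $4$-cycles sharing a common edge. -}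

module Defs where

open import Data.Empty using (⊥-elim) renaming (⊥ to Empty)
open import Data.Fin.Base using (Fin; zero; suc; toℕ; remQuot)
open import Data.Fin.Properties using (any?; all?) renaming (_≟_ to _≟ᶠ_)
open import Data.Fin.Subset
  using (Subset; inside; outside; ⊤; ∁; ∣_∣; _∈_; _∉_)
open import Data.Fin.Subset.Properties
  using (_∈?_; ∈⊤; anySubset?; ∣p∣≤n; ∣⊤∣≡n; ∣∁p∣≡n∸∣p∣; x∈p⇒∣p-x∣<∣p∣)
open import Data.Nat.Base using (ℕ; suc; _*_; _≤_; _<_; NonZero)
open import Data.Nat.Induction using (<-wellFounded)
open import Data.Nat.Properties
  using (_≤?_; _<?_; _≟_; ≮⇒≥; ≤-trans; ≤-reflexive; n∸n≡0; m<n⇒n≢0; n≤0⇒n≡0; 1+n≢n)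
open import Data.Product.Base using (∃; _×_; _,_; proj₁)
open import Data.Sum.Base using (_⊎_; inj₁; inj₂; swap) renaming (map to map-⊎)
open import Data.Vec.Base using ([]; _∷_; tabulate)
open import Induction.WellFounded using (Acc; acc)
open import Relation.Binary.Definitions using (Symmetric; Irreflexive)
  renaming (Decidable to Decidable₂)
open import Relation.Binary.PropositionalEquality
  using (_≡_; _≢_; refl; sym; trans; cong)
open import Relation.Nullary.Decidable.Core
  using (yes; no; does; ¬?; _×-dec_; _⊎-dec_; _→-dec_)
open import Relation.Nullary.Negation.Core using (¬_)
open import Relation.Unary using (Decidable)

-- The vertices are labelled by Fin order, which loses no finite graph up to
-- isomorphism.
record Graph : Set₁ where
  field
    order      : ℕ
    Adj        : Fin order → Fin order → Set
    adj?       : Decidable₂ Adj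
    adj-sym    : Symmetric Adj
    adj-irrefl : Irreflexive _≡_ Adj

  neighbours : Fin order → Subset order
  neighbours v = tabulate (λ u → does (adj? v u))

  deg : Fin order → ℕ
  deg v = ∣ neighbours v ∣

open Graph public

_IsMinimumSizeOf_ : ∀ {n} → ℕ → (Subset n → Set) → Set
k IsMinimumSizeOf P = (∃ λ D → P D × ∣ D ∣ ≡ k) × (∀ D → P D → k ≤ ∣ D ∣)

minimum : ∀ {n} {P : Subset n → Set} → Decidable P → ∃ P → ∃ (_IsMinimumSizeOf P)
minimum {n} {P} P? (D₀ , PD₀) = search D₀ PD₀ (<-wellFounded ∣ D₀ ∣)
  where
  search : ∀ D → P D → Acc _<_ ∣ D ∣ → ∃ (_IsMinimumSizeOf P)
  search D PD (acc rec) with anySubset? (λ D′ → P? D′ ×-dec (∣ D′ ∣ <? ∣ D ∣))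
  ... | yes (D′ , PD′ , smaller) = search D′ PD′ (rec smaller)
  ... | no none =
    ∣ D ∣ , (D , PD , refl) , λ D′ PD′ → ≮⇒≥ (λ smaller → none (D′ , PD′ , smaller))

StrongDominating : (G : Graph) → Subset (order G) → Set
StrongDominating G D =
  ∀ v → v ∉ D → ∃ λ u → u ∈ D × Adj G v u × deg G v ≤ deg G u

strongDominating? : (G : Graph) → Decidable (StrongDominating G)
strongDominating? G D = all? λ v → ¬? (v ∈? D) →-dec
  any? λ u → (u ∈? D) ×-dec (adj? G v u ×-dec (deg G v ≤? deg G u))

γst-minimum : (G : Graph) → ∃ (_IsMinimumSizeOf StrongDominating G)
γst-minimum G = minimum (strongDominating? G) (⊤ , λ v v∉⊤ → ⊥-elim (v∉⊤ ∈⊤))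

γst : Graph → ℕ
γst G = proj₁ (γst-minimum G)

-- The increasing enumeration of the elements of p.
element : ∀ {n} (p : Subset n) → Fin ∣ p ∣ → Fin n
element (inside  ∷ p) zero    = zero
element (inside  ∷ p) (suc i) = suc (element p i)
element (outside ∷ p) i       = suc (element p i)

-- The subgraph induced on V ∖ S, its vertices relabelled in increasing order.
_-ᴳ_ : (G : Graph) → Subset (order G) → Graph
G -ᴳ S = record
  { order      = ∣ ∁ S ∣
  ; Adj        = λ i j → Adj G (element (∁ S) i) (element (∁ S) j)
  ; adj?       = λ i j → adj? G (element (∁ S) i) (element (∁ S) j)
  ; adj-sym    = adj-sym G
  ; adj-irrefl = λ i≡j → adj-irrefl G (cong (element (∁ S)) i≡j)
  }

γst≤order : (G : Graph) → γst G ≤ order G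
γst≤order G with γst-minimum G
... | _ , (D , _ , refl) , _ = ∣p∣≤n D

γst≢0 : (G : Graph) → .{{NonZero (order G)}} → γst G ≢ 0
γst≢0 G {{nz}} γ≡0 with γst-minimum G
... | _ , (D , dom , refl) , _ = no-vertex (order G) {{nz}} λ v →
        let (u , u∈D , _) = dom v (empty v) in empty u u∈D
  where
  empty : ∀ v → v ∉ D
  empty v v∈D = m<n⇒n≢0 (x∈p⇒∣p-x∣<∣p∣ v∈D) γ≡0
  no-vertex : ∀ n → .{{NonZero n}} → ¬ (Fin n → Empty)
  no-vertex (suc n) f = f zero

-- Deleting every vertex of a nonempty graph changes γst, so the minimum
-- defining the stability is over a nonempty family; for the graph without
-- vertices it is undefined.
stγst-minimum : (G : Graph) → .{{NonZero (order G)}} →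
  ∃ (_IsMinimumSizeOf (λ S → γst (G -ᴳ S) ≢ γst G))
stγst-minimum G = minimum (λ S → ¬? (γst (G -ᴳ S) ≟ γst G)) (⊤ , changed)
  where
  order≡0 : order (G -ᴳ ⊤) ≡ 0
  order≡0 rewrite ∣∁p∣≡n∸∣p∣ (⊤ {order G}) | ∣⊤∣≡n (order G) = n∸n≡0 (order G)
  changed : γst (G -ᴳ ⊤) ≢ γst G
  changed eq = γst≢0 G (trans (sym eq)
    (n≤0⇒n≡0 (≤-trans (γst≤order (G -ᴳ ⊤)) (≤-reflexive order≡0))))

stγst : (G : Graph) → .{{NonZero (order G)}} → ℕ
stγst G = proj₁ (stγst-minimum G)

-- K₁,ₙ, with centre zero.
star : ℕ → Graph
star n = record
  { order      = suc n
  ; Adj        = λ i j → (i ≡ zero × j ≢ zero) ⊎ (j ≡ zero × i ≢ zero)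
  ; adj?       = λ i j → ((i ≟ᶠ zero) ×-dec ¬? (j ≟ᶠ zero))
                   ⊎-dec ((j ≟ᶠ zero) ×-dec ¬? (i ≟ᶠ zero))
  ; adj-sym    = swap
  ; adj-irrefl = λ { refl (inj₁ (p , q)) → q p ; refl (inj₂ (p , q)) → q p }
  }

-- The path on n vertices.
path : ℕ → Graph
path n = record
  { order      = n
  ; Adj        = λ i j → suc (toℕ i) ≡ toℕ j ⊎ suc (toℕ j) ≡ toℕ i
  ; adj?       = λ i j → (suc (toℕ i) ≟ toℕ j) ⊎-dec (suc (toℕ j) ≟ toℕ i)
  ; adj-sym    = swap
  ; adj-irrefl = λ { refl (inj₁ p) → 1+n≢n p ; refl (inj₂ p) → 1+n≢n p }
  }

-- The Cartesian product; the vertex labels encode pairs through remQuot.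
_□_ : Graph → Graph → Graph
G □ H = record
  { order      = order G * order H
  ; Adj        = λ x y → Adj′ (pair x) (pair y)
  ; adj?       = λ x y → adj′? (pair x) (pair y)
  ; adj-sym    = map-⊎ (λ (p , a) → sym p , adj-sym H a) (λ (p , a) → sym p , adj-sym G a)
  ; adj-irrefl = λ { refl (inj₁ (_ , a)) → adj-irrefl H refl a
                   ; refl (inj₂ (_ , a)) → adj-irrefl G refl a }
  }
  where
  Vertex : Set
  Vertex = Fin (order G) × Fin (order H)
  pair : Fin (order G * order H) → Vertex
  pair = remQuot {order G} (order H)
  Adj′ : Vertex → Vertex → Set
  Adj′ (g , h) (g′ , h′) = (g ≡ g′ × Adj H h h′) ⊎ (h ≡ h′ × Adj G g g′)
  adj′? : Decidable₂ Adj′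
  adj′? (g , h) (g′ , h′) =
    ((g ≟ᶠ g′) ×-dec adj? H h h′) ⊎-dec ((h ≟ᶠ h′) ×-dec adj? G g g′)

book : ℕ → Graph
book n = star n □ path 2

{-# OPTIONS --safe #-}

-- The two spine vertices of Bₙ have the maximum degree and dominate all pages,
-- so γst(Bₙ) ≤ 2. Once one spine vertex is deleted, each of the n pages has a
-- vertex whose only neighbour is on the same page, so a dominating set meets
-- every page and γst ≥ n ≥ 3.
module Submission where

open import Defs
open import Data.Nat.Base using (ℕ; _≤_)
open import Relation.Binary.PropositionalEquality using (_≡_)

open import Data.Empty using (⊥-elim)
open import Data.Fin.Base using (Fin; zero; suc; cast; combine; opposite)
open import Data.Fin.Properties
  using (0≢1+n; suc-injective; cast-is-id; remQuot-combine;
         combine-injectiveˡ; combine-surjective)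
open import Data.Fin.Subset
  using (Subset; inside; outside; ∁; ∣_∣; _∈_; _⊆_; _∪_; ⁅_⁆)
open import Data.Fin.Subset.Properties
  using (_∈?_; ∣p∣≤n; ∣∁p∣≡n∸∣p∣; ∣⁅x⁆∣≡1; p⊆q⇒∣p∣≤∣q∣;
         x∈p∪q⁺; x∈⁅x⁆; x∈⁅y⁆⇒x≡y; x∈p⇒∣p-x∣<∣p∣; x∈p∧x≢y⇒x∈p-y;
         x∉p⇒x∈∁p; x∈∁p⇒x∉p)
open import Data.Nat.Base using (zero; suc; _+_; _∸_; z≤n; s≤s)
open import Data.Nat.Properties
  using (≤-trans; ≤-reflexive; ≤-antisym; +-suc; +-monoʳ-≤; n≤1+n; <⇒≱; 1+n≰n; n≢0⇒n>0)
  renaming (suc-injective to ℕ-suc-injective)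
open import Data.Product.Base using (∃; _×_; _,_; proj₁; proj₂)
open import Data.Sum.Base using (_⊎_; inj₁; inj₂; [_,_]′)
open import Data.Vec.Base using ([]; _∷_; here; there)
open import Data.Vec.Properties
  using (lookup∘tabulate; lookup⇒[]=; []=⇒lookup; tabulate-cong)
open import Function.Base using (_∘_; id)
open import Function.Bundles using (_⇔_; mk⇔; module Equivalence)
open import Function.Definitions using (Injective)
open import Relation.Binary.PropositionalEquality
  using (_≢_; refl; sym; trans; cong; cong₂; subst; subst₂)
open import Relation.Nullary.Decidable using (yes; no; dec-true; does-⇔)

private
  pattern one = suc zero

-- Cardinalities of subsets.

injection⇒≤∣p∣ : ∀ {k n} {p : Subset n} (f : Fin k → Fin n) →
  Injective _≡_ _≡_ f → (∀ i → f i ∈ p) → k ≤ ∣ p ∣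
injection⇒≤∣p∣ {zero}  f inj f∈p = z≤n
injection⇒≤∣p∣ {suc k} f inj f∈p = ≤-trans
  -- By injectivity the remaining values survive the removal of `f zero`, which makes `p` strictly
  -- smaller.
  (s≤s (injection⇒≤∣p∣ (f ∘ suc) (suc-injective ∘ inj)
    (λ i → x∈p∧x≢y⇒x∈p-y (f∈p (suc i)) λ eq → 0≢1+n (sym (inj eq)))))
  (x∈p⇒∣p-x∣<∣p∣ (f∈p zero))

∣p∪q∣≤∣p∣+∣q∣ : ∀ {n} (p q : Subset n) → ∣ p ∪ q ∣ ≤ ∣ p ∣ + ∣ q ∣
∣p∪q∣≤∣p∣+∣q∣ []            []            = z≤n
∣p∪q∣≤∣p∣+∣q∣ (outside ∷ p) (outside ∷ q) = ∣p∪q∣≤∣p∣+∣q∣ p q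
∣p∪q∣≤∣p∣+∣q∣ (outside ∷ p) (inside  ∷ q) = ≤-trans
  (s≤s (∣p∪q∣≤∣p∣+∣q∣ p q)) (≤-reflexive (sym (+-suc ∣ p ∣ ∣ q ∣)))
∣p∪q∣≤∣p∣+∣q∣ (inside  ∷ p) (outside ∷ q) = s≤s (∣p∪q∣≤∣p∣+∣q∣ p q)
∣p∪q∣≤∣p∣+∣q∣ (inside  ∷ p) (inside  ∷ q) = s≤s (≤-trans
  (∣p∪q∣≤∣p∣+∣q∣ p q) (+-monoʳ-≤ ∣ p ∣ (n≤1+n ∣ q ∣)))

∣⁅x⁆∪⁅y⁆∣≤2 : ∀ {n} (x y : Fin n) → ∣ ⁅ x ⁆ ∪ ⁅ y ⁆ ∣ ≤ 2
∣⁅x⁆∪⁅y⁆∣≤2 x y = ≤-trans (∣p∪q∣≤∣p∣+∣q∣ ⁅ x ⁆ ⁅ y ⁆)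
  (≤-reflexive (cong₂ _+_ (∣⁅x⁆∣≡1 x) (∣⁅x⁆∣≡1 y)))

x∈⁅x⁆∪⁅y⁆ : ∀ {n} (x y : Fin n) → x ∈ ⁅ x ⁆ ∪ ⁅ y ⁆
x∈⁅x⁆∪⁅y⁆ x y = x∈p∪q⁺ (inj₁ (x∈⁅x⁆ x))

y∈⁅x⁆∪⁅y⁆ : ∀ {n} (x y : Fin n) → y ∈ ⁅ x ⁆ ∪ ⁅ y ⁆
y∈⁅x⁆∪⁅y⁆ x y = x∈p∪q⁺ {p = ⁅ x ⁆} (inj₂ (x∈⁅x⁆ y))

-- The enumeration of a subset.

element-∈ : ∀ {n} (p : Subset n) i → element p i ∈ p
element-∈ (inside  ∷ p) zero    = here
element-∈ (inside  ∷ p) (suc i) = there (element-∈ p i)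
element-∈ (outside ∷ p) i       = there (element-∈ p i)

element-surjective : ∀ {n} {p : Subset n} {x} → x ∈ p → ∃ λ i → element p i ≡ x
element-surjective {p = inside ∷ p} here = zero , refl
element-surjective {p = inside ∷ p} (there x∈p) =
  let (i , eq) = element-surjective x∈p in suc i , cong suc eq
element-surjective {p = outside ∷ p} (there x∈p) =
  let (i , eq) = element-surjective x∈p in i , cong suc eq

-- A subset of full size has no `outside` entry, since its tail would then have more elements than
-- places; so the enumeration skips nothing.
element≡cast : ∀ {n} (p : Subset n) (eq : ∣ p ∣ ≡ n) i → element p i ≡ cast eq i
element≡cast (inside  ∷ p) eq zero    = refl
element≡cast (inside  ∷ p) eq (suc i) =
  cong suc (element≡cast p (ℕ-suc-injective eq) i)
element≡cast (outside ∷ p) eq i =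
  ⊥-elim (1+n≰n (≤-trans (≤-reflexive (sym eq)) (∣p∣≤n p)))

-- Strong domination under relabelling and deletion.

module _ (G : Graph) where

  ∈-neighbours⁺ : ∀ v u → Adj G v u → u ∈ neighbours G v
  ∈-neighbours⁺ v u a = lookup⇒[]= u _
    (trans (lookup∘tabulate _ u) (dec-true (adj? G v u) a))

  ∈-neighbours⁻ : ∀ v u → u ∈ neighbours G v → Adj G v u
  ∈-neighbours⁻ v u u∈N
    -- In the `no` case the second equation becomes `false ≡ true`, so only `yes` remains.
    with adj? G v u | trans (sym (lookup∘tabulate _ u)) ([]=⇒lookup u∈N)
  ... | yes a | _ = a

  γst≤ : ∀ {D} → StrongDominating G D → γst G ≤ ∣ D ∣
  γst≤ = proj₂ (proj₂ (γst-minimum G)) _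

  γst-attained : ∃ λ D → StrongDominating G D × ∣ D ∣ ≡ γst G
  γst-attained = proj₁ (proj₂ (γst-minimum G))

-- The relabelling preserves degrees as well as adjacency, so a minimum strong dominating set of `G`
-- also serves `H`. Equality follows by using the lemma in both directions.
γst-cong-≤ : (G H : Graph) (eq : order G ≡ order H) →
  (∀ i j → Adj G i j ⇔ Adj H (cast eq i) (cast eq j)) → γst H ≤ γst G
-- The record patterns expose the two orders, so that `refl` can identify them and both graphs share
-- one type of subsets.
γst-cong-≤ G@record { order = n } H@record { order = n } refl adj⇔ =
  let (D , dom , ∣D∣≡) = γst-attained G in
  ≤-trans (γst≤ H (transfer D dom)) (≤-reflexive ∣D∣≡)
  where
  adj⇔′ : ∀ i j → Adj G i j ⇔ Adj H i j
  adj⇔′ i j = subst₂ (λ x y → Adj G i j ⇔ Adj H x y)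
    (cast-is-id refl i) (cast-is-id refl j) (adj⇔ i j)
  deg≡ : ∀ v → deg G v ≡ deg H v
  deg≡ v = cong ∣_∣
    (tabulate-cong λ u → does-⇔ (adj⇔′ v u) (adj? G v u) (adj? H v u))
  transfer : ∀ D → StrongDominating G D → StrongDominating H D
  transfer D dom v v∉D = let (u , u∈D , a , d) = dom v v∉D in
    u , u∈D , Equivalence.to (adj⇔′ v u) a , subst₂ _≤_ (deg≡ v) (deg≡ u) d

-- This excludes stability 0. The order of `G -ᴳ S` is only propositionally that of `G`, so the two
-- graphs are compared through `cast`.
γst-delete-∅ : (G : Graph) (S : Subset (order G)) → ∣ S ∣ ≡ 0 →
  γst (G -ᴳ S) ≡ γst G
γst-delete-∅ G S ∣S∣≡0 = ≤-antisym
  (γst-cong-≤ G (G -ᴳ S) (sym eq) λ i j → ⇔-of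
    (sym (trans (element≡cast (∁ S) eq _) (cast-cancel eq i)))
    (sym (trans (element≡cast (∁ S) eq _) (cast-cancel eq j))))
  (γst-cong-≤ (G -ᴳ S) G eq λ i j → ⇔-of
    (element≡cast (∁ S) eq i) (element≡cast (∁ S) eq j))
  where
  eq : ∣ ∁ S ∣ ≡ order G
  eq = trans (∣∁p∣≡n∸∣p∣ S) (cong (order G ∸_) ∣S∣≡0)
  ⇔-of : ∀ {x x′ y y′} → x ≡ x′ → y ≡ y′ → Adj G x y ⇔ Adj G x′ y′
  ⇔-of refl refl = mk⇔ id id
  cast-cancel : ∀ {m n} (m≡n : m ≡ n) i → cast m≡n (cast (sym m≡n) i) ≡ i
  cast-cancel refl i = trans (cast-is-id refl _) (cast-is-id refl i)

-- Restates domination in `G -ᴳ S` through the original vertices, so that the adjacency of `G` can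
-- be analysed directly.
dominator-in-deletion : (G : Graph) (S : Subset (order G)) →
  ∀ {D} → StrongDominating (G -ᴳ S) D → ∀ {v} → v ∈ ∁ S →
  ∃ λ d → d ∈ D × (element (∁ S) d ≡ v ⊎ Adj G v (element (∁ S) d))
dominator-in-deletion G S {D} dom v∈∁S with element-surjective v∈∁S
... | d , refl with d ∈? D
...   | yes d∈D = d , d∈D , inj₁ refl
...   | no  d∉D = let (u , u∈D , a , _) = dom d d∉D in u , u∈D , inj₂ a

-- Adjacency in Cartesian products and in the path on two vertices.

module _ (G H : Graph) where

  -- `remQuot` does not compute on `combine g h` for variables; an equation between types lets
  -- `subst id` move adjacency proofs both ways.
  □-adj-pair : ∀ g h g′ h′ → Adj (G □ H) (combine g h) (combine g′ h′) ≡
    ((g ≡ g′ × Adj H h h′) ⊎ (h ≡ h′ × Adj G g g′))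
  □-adj-pair g h g′ h′ =
    cong₂ (λ (x , y) (x′ , y′) → (x ≡ x′ × Adj H y y′) ⊎ (y ≡ y′ × Adj G x x′))
      (remQuot-combine g h) (remQuot-combine g′ h′)

  □-edgeˡ : ∀ g g′ h → Adj G g g′ → Adj (G □ H) (combine g h) (combine g′ h)
  □-edgeˡ g g′ h a = subst id (sym (□-adj-pair g h g′ h)) (inj₂ (refl , a))

  □-edgeʳ : ∀ g h h′ → Adj H h h′ → Adj (G □ H) (combine g h) (combine g h′)
  □-edgeʳ g h h′ a = subst id (sym (□-adj-pair g h g h′)) (inj₁ (refl , a))

path₂-adj-opposite : ∀ h → Adj (path 2) h (opposite h)
path₂-adj-opposite zero = inj₁ refl
path₂-adj-opposite one  = inj₂ refl

path₂-adj⁻ : ∀ h h′ → Adj (path 2) h h′ → h′ ≡ opposite h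
path₂-adj⁻ zero zero (inj₁ ())
path₂-adj⁻ zero zero (inj₂ ())
path₂-adj⁻ zero one  _ = refl
path₂-adj⁻ one  zero _ = refl
path₂-adj⁻ one  one  (inj₁ ())
path₂-adj⁻ one  one  (inj₂ ())

-- Spine and pages of the book graph.

module _ (n : ℕ) where

  -- In the star `zero` is the centre and `suc i` a leaf, so `spine` gives the ends of the common
  -- edge and `page i` the other two vertices of the `i`-th 4-cycle.
  spine : Fin 2 → Fin (order (book n))
  spine = combine {suc n} {2} zero

  page : Fin n → Fin 2 → Fin (order (book n))
  page i = combine {suc n} {2} (suc i)

  page-adj⁻ : ∀ (i : Fin n) h y → Adj (book n) (page i h) y →
    y ≡ spine h ⊎ y ≡ page i (opposite h)
  page-adj⁻ i h y a with combine-surjective {suc n} {2} y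
  ... | g′ , h′ , refl with subst id (□-adj-pair (star n) (path 2) (suc i) h g′ h′) a
  ...   | inj₁ (refl , b) = inj₂ (cong (page i) (path₂-adj⁻ h h′ b))
  ...   | inj₂ (refl , inj₁ (() , _))
  ...   | inj₂ (refl , inj₂ (refl , _)) = inj₁ refl

  deg-page≤2 : ∀ (i : Fin n) h → deg (book n) (page i h) ≤ 2
  deg-page≤2 i h = ≤-trans
    (p⊆q⇒∣p∣≤∣q∣ N⊆) (∣⁅x⁆∪⁅y⁆∣≤2 (spine h) (page i (opposite h)))
    where
    N⊆ : neighbours (book n) (page i h) ⊆ ⁅ spine h ⁆ ∪ ⁅ page i (opposite h) ⁆
    N⊆ {y} y∈N with page-adj⁻ i h y (∈-neighbours⁻ (book n) (page i h) y y∈N)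
    ... | inj₁ refl = x∈⁅x⁆∪⁅y⁆ (spine h) (page i (opposite h))
    ... | inj₂ refl = y∈⁅x⁆∪⁅y⁆ (spine h) (page i (opposite h))

  -- The argument of type `Fin n` supplies a page, hence a second neighbour besides the other spine
  -- vertex.
  2≤deg-spine : Fin n → ∀ h → 2 ≤ deg (book n) (spine h)
  2≤deg-spine i h = injection⇒≤∣p∣ f inj f∈N
    where
    f : Fin 2 → Fin (order (book n))
    f zero = spine (opposite h)
    f one  = page i h
    spine≢page : spine (opposite h) ≢ page i h
    spine≢page eq = 0≢1+n (combine-injectiveˡ zero (opposite h) (suc i) h eq)
    inj : Injective _≡_ _≡_ f
    inj {zero} {zero} _  = refl
    inj {zero} {one}  eq = ⊥-elim (spine≢page eq)
    inj {one}  {zero} eq = ⊥-elim (spine≢page (sym eq))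
    inj {one}  {one}  _  = refl
    f∈N : ∀ j → f j ∈ neighbours (book n) (spine h)
    f∈N zero = ∈-neighbours⁺ (book n) (spine h) (spine (opposite h))
      (□-edgeʳ (star n) (path 2) zero h (opposite h) (path₂-adj-opposite h))
    f∈N one  = ∈-neighbours⁺ (book n) (spine h) (page i h)
      (□-edgeˡ (star n) (path 2) zero (suc i) h (inj₁ (refl , λ ())))

  γst-book≤2 : γst (book n) ≤ 2
  γst-book≤2 = ≤-trans (γst≤ (book n) dom) (∣⁅x⁆∪⁅y⁆∣≤2 (spine zero) (spine one))
    where
    D : Subset (order (book n))
    D = ⁅ spine zero ⁆ ∪ ⁅ spine one ⁆
    spine∈D : ∀ h → spine h ∈ D
    spine∈D zero = x∈⁅x⁆∪⁅y⁆ (spine zero) (spine one)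
    spine∈D one  = y∈⁅x⁆∪⁅y⁆ (spine zero) (spine one)
    dom : StrongDominating (book n) D
    dom v v∉D with combine-surjective {suc n} {2} v
    ... | zero  , h , refl = ⊥-elim (v∉D (spine∈D h))
    -- The spine vertex in the same copy of the star dominates; the two degrees are compared through
    -- 2.
    ... | suc i , h , refl = spine h , spine∈D h ,
      □-edgeˡ (star n) (path 2) (suc i) zero h (inj₂ (refl , λ ())) ,
      ≤-trans (deg-page≤2 i h) (2≤deg-spine i h)

  n≤γst-book-minus-spine : n ≤ γst (book n -ᴳ ⁅ spine one ⁆)
  n≤γst-book-minus-spine =
    let (D , dom , ∣D∣≡) = γst-attained (book n -ᴳ ⁅ spine one ⁆) in
    ≤-trans (n≤∣D∣ D dom) (≤-reflexive ∣D∣≡)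
    where
    p : Subset (order (book n))
    p = ∁ ⁅ spine one ⁆
    page∈p : ∀ i → page i one ∈ p
    page∈p i = x∉p⇒x∈∁p λ v∈ → 0≢1+n
      (sym (combine-injectiveˡ (suc i) one zero one (x∈⁅y⁆⇒x≡y (spine one) v∈)))
    -- The deleted vertex was the only neighbour of `page i one` off page `i`, so any dominator of
    -- `page i one` lies on that page.
    on-page : ∀ i {y} → y ∈ p → y ≡ page i one ⊎ Adj (book n) (page i one) y →
      ∃ λ h → y ≡ page i h
    on-page i y∈p (inj₁ y≡page) = one , y≡page
    on-page i {y} y∈p (inj₂ a)  = [ off-spine , zero ,_ ]′ (page-adj⁻ i one y a)
      where
      off-spine : y ≡ spine one → ∃ λ h → y ≡ page i h
      off-spine y≡spine = ⊥-elim (x∈∁p⇒x∉p y∈p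
        (subst (_∈ ⁅ spine one ⁆) (sym y≡spine) (x∈⁅x⁆ (spine one))))
    module _ D (dom : StrongDominating (book n -ᴳ ⁅ spine one ⁆) D) where
      meets-page : ∀ i → ∃ λ d → d ∈ D × ∃ λ h → element p d ≡ page i h
      meets-page i =
        let (d , d∈D , near) =
              dominator-in-deletion (book n) ⁅ spine one ⁆ dom (page∈p i)
        in d , d∈D , on-page i (element-∈ p d) near
      f : Fin n → Fin ∣ p ∣
      f i = proj₁ (meets-page i)
      -- Pages are disjoint: the star coordinate of a common dominator determines the page.
      f-injective : Injective _≡_ _≡_ f
      f-injective {i} {j} eq =
        let (_ , _ , h , on-i) = meets-page i
            (_ , _ , k , on-j) = meets-page j
        in suc-injective (combine-injectiveˡ (suc i) h (suc j) k
             (trans (sym on-i) (trans (cong (element p) eq) on-j)))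
      n≤∣D∣ : n ≤ ∣ D ∣
      n≤∣D∣ = injection⇒≤∣p∣ f f-injective λ i → proj₁ (proj₂ (meets-page i))

proposition2p7 : (n : ℕ) → 3 ≤ n → stγst (book n) ≡ 1
proposition2p7 n 3≤n =
  let (S , changes , ∣S∣≡) , least = proj₂ (stγst-minimum (book n)) in
  ≤-antisym
    (≤-trans (least ⁅ spine n one ⁆ spine-changes) (≤-reflexive (∣⁅x⁆∣≡1 (spine n one))))
    -- If the minimum were 0, the set `S` attaining it would be empty and could not change `γst`.
    (n≢0⇒n>0 λ st≡0 → changes (γst-delete-∅ (book n) S (trans ∣S∣≡ st≡0)))
  where
  spine-changes : γst (book n -ᴳ ⁅ spine n one ⁆) ≢ γst (book n)
  -- Equality would give `n ≤ 2`.
  spine-changes eq = <⇒≱ 3≤n (≤-trans (n≤γst-book-minus-spine n)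
    (≤-trans (≤-reflexive eq) (γst-book≤2 n)))
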